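{- Let $k\ge 1$ and $n\ge 1$ be integers. The number of $k$-Schröder paths of type A of size $n$ is given by $$|\mathtt{Sch}^{A}(n;k)|=\frac{1}{n}\sum_{j=0}^{n}\binom{n}{j}\binom{n+kj}{n-1}.$$
   Context: A $k$-Schröder path of type A of size $n$ is a lattice path from $(0,0)$ to $(kn,n)$ consisting of up steps $U=(0,1)$, down steps $D=(1,0)$ and horizontal steps $H=(k,1)$, which never goes below the line $y=x/k$. The set of such paths is denoted $\mathtt{Sch}^{A}(n;k)$. -}

module Defs where

open import Data.List.Base using (List; []; _∷_)
open import Data.List.Relation.Unary.All using (All)
open import Data.Nat.Base using (ℕ; _+_; _*_; _≤_)
open import Data.Product.Base using (_×_; _,_)
open import Relation.Binary.PropositionalEquality.Core using (_≡_)

-- All steps have non-negative coordinates, so paths from the origin stay in ℕ × ℕ.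
Point : Set
Point = ℕ × ℕ

_⊕_ : Point → Point → Point
(x , y) ⊕ (x′ , y′) = (x + x′ , y + y′)

data Step : Set where
  U D H : Step

⟦_⟧ : Step → ℕ → Point
⟦ U ⟧ k = (0 , 1)
⟦ D ⟧ k = (1 , 0)
⟦ H ⟧ k = (k , 1)

endpoint : ℕ → Point → List Step → Point
endpoint k p []       = p
endpoint k p (s ∷ ss) = endpoint k (p ⊕ ⟦ s ⟧ k) ss

-- The vertices of the path, including both ends.
vertices : ℕ → Point → List Step → List Point
vertices k p []       = p ∷ []
vertices k p (s ∷ ss) = p ∷ vertices k (p ⊕ ⟦ s ⟧ k) ss

-- (x , y) is on or above the line y = x / k, with the denominator cleared.
-- As steps are line segments, it is enough to impose this at the vertices.
NotBelow : ℕ → Point → Set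
NotBelow k (x , y) = x ≤ k * y

-- Both proof fields are propositions (ℕ × ℕ is a set and _≤_ is
-- proof-irrelevant), so elements of SchA n k are counted by their step sequence.
record SchA (n k : ℕ) : Set where
  constructor mkSchA
  field
    steps     : List Step
    ends      : endpoint k (0 , 0) steps ≡ (k * n , n)
    notBelow  : All (NotBelow k) (vertices k (0 , 0) steps)

{-# OPTIONS --safe #-}
-- Let h = k y − x be the height of a vertex: U, D and H change it by k, −1 and 0.
-- With T m a the number of ways to finish from height a − 1 when m steps U or H
-- remain, deleting the first step gives
--   T (m+1) (a+1) = T (m+1) a + T m (a+1+k) + T m (a+1),   T (m+1) 0 = 0.
-- Put B m p c = [uᵖ] (1+u)ᶜ (1+(1+u)ᵏ)ᵐ = Σⱼ C(m,j) C(c+kj,p).  The recurrence gives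
--   T (m+1) a = B (m+1) (m+1) (m+a) − k B m m (m+a+k),
-- and comparing the coefficients of (1+u) d/du of the generating function turns this into
--   (m+1) T (m+1) a = a B (m+1) m (m+a),
-- of which the theorem is the case a = 1.
module Submission where

open import Axiom.UniquenessOfIdentityProofs using (module Decidable⇒UIP)
open import Data.Fin.Base using (Fin)
open import Data.Fin.Properties using (+↔⊎; 1↔⊤)
open import Data.Integer.Base as ℤ using (+_)
import Data.Integer.Properties as ℤ
open import Data.List.Base using (List; []; _∷_; map; upTo; applyUpTo; _∷ʳ_)
open import Data.List.Properties using (map-upTo; applyUpTo-∷ʳ; ∷-injectiveʳ)
open import Data.List.Relation.Unary.All as All using (All; []; _∷_)
open import Data.Nat.Base using (ℕ; zero; suc; _+_; _*_; _∸_; NonZero)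
open import Data.Nat.Combinatorics using (_C_; nC1≡n; nCk+nC[k+1]≡[n+1]C[k+1]; k>n⇒nCk≡0)
open import Data.Nat.ListAction using (sum)
open import Data.Nat.ListAction.Properties using (sum-++)
open import Data.Nat.Properties
open import Algebra.Properties.CommutativeSemigroup +-commutativeSemigroup using (interchange)
open import Data.Nat.Tactic.RingSolver using (solve-∀)
open import Data.Product.Base using (Σ; ∃-syntax; _×_; _,_; proj₁; proj₂)
open import Data.Product.Properties using (≡-dec)
open import Data.Rational.Base using (_/_; toℚᵘ) renaming (_*_ to _*ℚ_)
open import Data.Rational.Properties using (toℚᵘ-injective; toℚᵘ-fromℚᵘ; toℚᵘ-homo-*)
open import Data.Rational.Unnormalised.Base using (mkℚᵘ; *≡*) renaming (_*_ to _*ᵘ_)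
import Data.Rational.Unnormalised.Properties as ℚᵘ
open import Data.Sum.Base using (_⊎_; inj₁; inj₂)
open import Data.Sum.Function.Propositional using (_⊎-cong_)
open import Data.Unit.Base using (⊤; tt)
open import Function.Base using (_∘_)
open import Function.Bundles using (_↔_; mk↔ₛ′)
open import Function.Construct.Composition using (_↔-∘_)
open import Function.Construct.Symmetry using (↔-sym)
open import Relation.Binary.PropositionalEquality
  using (_≡_; refl; sym; trans; cong; cong₂; subst; module ≡-Reasoning)
open import Defs

-- Binomial sums

-- Σⱼ C(m,j) f(c+kj), in a form where Pascal's rule in m holds by definition.
binomialSum : ℕ → (ℕ → ℕ) → ℕ → ℕ → ℕ
binomialSum k f zero    c = f c
binomialSum k f (suc m) c = binomialSum k f m c + binomialSum k f m (c + k)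

sum-applyUpTo-cong : ∀ {f g : ℕ → ℕ} → (∀ i → f i ≡ g i) → ∀ n →
                     sum (applyUpTo f n) ≡ sum (applyUpTo g n)
sum-applyUpTo-cong f≗g zero    = refl
sum-applyUpTo-cong f≗g (suc n) = cong₂ _+_ (f≗g 0) (sum-applyUpTo-cong (f≗g ∘ suc) n)

sum-applyUpTo-+ : ∀ (f g : ℕ → ℕ) n →
                  sum (applyUpTo (λ i → f i + g i) n) ≡ sum (applyUpTo f n) + sum (applyUpTo g n)
sum-applyUpTo-+ f g zero    = refl
sum-applyUpTo-+ f g (suc n) =
  trans (cong (λ s → f 0 + g 0 + s) (sum-applyUpTo-+ (f ∘ suc) (g ∘ suc) n))
        (interchange (f 0) (g 0) _ _)

sum-applyUpTo-last : ∀ (f : ℕ → ℕ) n → sum (applyUpTo f (suc n)) ≡ sum (applyUpTo f n) + f n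
sum-applyUpTo-last f n = begin
  sum (applyUpTo f (suc n))         ≡⟨ cong sum (applyUpTo-∷ʳ f n) ⟨
  sum (applyUpTo f n ∷ʳ f n)        ≡⟨ sum-++ (applyUpTo f n) (f n ∷ []) ⟩
  sum (applyUpTo f n) + (f n + 0)   ≡⟨ cong (λ x → sum (applyUpTo f n) + x) (+-identityʳ (f n)) ⟩
  sum (applyUpTo f n) + f n         ∎
  where open ≡-Reasoning

-- Pascal's rule summed against a weight: the term from C(m,j-1) becomes, after reindexing, the same
-- kind of sum with the weight shifted by one.
sum-C-suc : ∀ (g : ℕ → ℕ) m →
            sum (applyUpTo (λ j → (suc m C j) * g j) (suc (suc m))) ≡
            sum (applyUpTo (λ j → (m C j) * g j) (suc m)) +
            sum (applyUpTo (λ j → (m C j) * g (suc j)) (suc m))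
sum-C-suc g m = begin
  1 * g 0 + sum (applyUpTo (λ j → (suc m C suc j) * g (suc j)) (suc m))
    ≡⟨ cong (λ s → 1 * g 0 + s) (sum-applyUpTo-cong pascal (suc m)) ⟩
  1 * g 0 + sum (applyUpTo (λ j → F (suc j) + G j) (suc m))
    ≡⟨ cong (λ s → 1 * g 0 + s) (sum-applyUpTo-+ (F ∘ suc) G (suc m)) ⟩
  1 * g 0 + (sum (applyUpTo (F ∘ suc) (suc m)) + sum (applyUpTo G (suc m)))
    ≡⟨ +-assoc (1 * g 0) _ _ ⟨
  sum (applyUpTo F (suc (suc m))) + sum (applyUpTo G (suc m))
    ≡⟨ cong (_+ sum (applyUpTo G (suc m))) (sum-applyUpTo-last F (suc m)) ⟩
  sum (applyUpTo F (suc m)) + F (suc m) + sum (applyUpTo G (suc m))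
    -- The range is one too long for row `m`; its last term vanishes because C(m,m+1) = 0.
    ≡⟨ cong (λ x → sum (applyUpTo F (suc m)) + x * g (suc m) + sum (applyUpTo G (suc m)))
            (k>n⇒nCk≡0 (n<1+n m)) ⟩
  sum (applyUpTo F (suc m)) + 0 + sum (applyUpTo G (suc m))
    ≡⟨ cong (_+ sum (applyUpTo G (suc m))) (+-identityʳ (sum (applyUpTo F (suc m)))) ⟩
  sum (applyUpTo F (suc m)) + sum (applyUpTo G (suc m)) ∎
  where
  open ≡-Reasoning
  F G : ℕ → ℕ
  F j = (m C j) * g j
  G j = (m C j) * g (suc j)
  pascal : ∀ j → (suc m C suc j) * g (suc j) ≡ F (suc j) + G j
  pascal j = begin
    (suc m C suc j) * g (suc j)           ≡⟨ cong (_* g (suc j)) (nCk+nC[k+1]≡[n+1]C[k+1] m j) ⟨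
    (m C j + (m C suc j)) * g (suc j)     ≡⟨ *-distribʳ-+ (g (suc j)) (m C j) _ ⟩
    G j + F (suc j)                       ≡⟨ +-comm (G j) _ ⟩
    F (suc j) + G j                       ∎

-- Induction on `m`: raising `j` by one adds `k` to the argument of `f`, so the shifted half of
-- Pascal's rule is the sum started at `c + k`.
sum-C≡binomialSum : ∀ k f m c →
                    sum (applyUpTo (λ j → (m C j) * f (c + k * j)) (suc m)) ≡ binomialSum k f m c
sum-C≡binomialSum k f zero c = begin
  1 * f (c + k * 0) + 0 ≡⟨ +-identityʳ _ ⟩
  1 * f (c + k * 0)     ≡⟨ *-identityˡ _ ⟩
  f (c + k * 0)         ≡⟨ cong (λ x → f (c + x)) (*-zeroʳ k) ⟩
  f (c + 0)             ≡⟨ cong f (+-identityʳ c) ⟩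
  f c                   ∎
  where open ≡-Reasoning
sum-C≡binomialSum k f (suc m) c =
  trans (sum-C-suc (λ j → f (c + k * j)) m)
        (cong₂ _+_ (sum-C≡binomialSum k f m c)
                   (trans (sum-applyUpTo-cong (λ j → cong (λ x → (m C j) * f x) (shift c k j)) (suc m))
                          (sum-C≡binomialSum k f m (c + k))))
  where
  shift : ∀ c k j → c + k * suc j ≡ c + k + k * j
  shift = solve-∀

-- Pascal's rule termwise; on generating functions, multiplication by 1+u.
binomialSum-C-suc : ∀ k m p c → binomialSum k (_C suc p) m (suc c) ≡
                    binomialSum k (_C p) m c + binomialSum k (_C suc p) m c
binomialSum-C-suc k zero    p c = sym (nCk+nC[k+1]≡[n+1]C[k+1] c p)
binomialSum-C-suc k (suc m) p c =
  trans (cong₂ _+_ (binomialSum-C-suc k m p c) (binomialSum-C-suc k m p (c + k)))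
        (interchange (binomialSum k (_C p) m c) _ _ _)

-- The identity (p+1) C(c,p+1) = (c-p) C(c,p) without subtraction, hence valid for p > c too. It
-- compares coefficients of uᵖ in (1+u) d/du (1+u)ᶜ = c (1+u)ᶜ.
C-absorb : ∀ c p → suc p * (c C suc p) + p * (c C p) ≡ c * (c C p)
C-absorb zero    zero    = refl
C-absorb zero    (suc p) rewrite *-zeroʳ p = refl
C-absorb (suc c) zero    = trans (cong (λ x → 1 * x + 0) (nC1≡n (suc c))) (arith c)
  where
  arith : ∀ c → 1 * suc c + 0 ≡ suc c * 1
  arith = solve-∀
C-absorb (suc c) (suc q) = begin
  suc (suc q) * (suc c C suc (suc q)) + suc q * (suc c C suc q)
    ≡⟨ cong₂ (λ x y → suc (suc q) * x + suc q * y)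
             (nCk+nC[k+1]≡[n+1]C[k+1] c (suc q)) (nCk+nC[k+1]≡[n+1]C[k+1] c q) ⟨
  suc (suc q) * (c₁ + c₂) + suc q * (c₀ + c₁)
    ≡⟨ regroup q c₀ c₁ c₂ ⟩
  (suc (suc q) * c₂ + suc q * c₁) + (suc q * c₁ + q * c₀) + (c₀ + c₁)
    ≡⟨ cong₂ (λ x y → x + y + (c₀ + c₁)) (C-absorb c (suc q)) (C-absorb c q) ⟩
  c * c₁ + c * c₀ + (c₀ + c₁)
    ≡⟨ collect c c₀ c₁ ⟩
  suc c * (c₀ + c₁)
    ≡⟨ cong (suc c *_) (nCk+nC[k+1]≡[n+1]C[k+1] c q) ⟩
  suc c * (suc c C suc q) ∎
  where
  open ≡-Reasoning
  c₀ c₁ c₂ : ℕ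
  c₀ = c C q
  c₁ = c C suc q
  c₂ = c C suc (suc q)
  regroup : ∀ q x y z → suc (suc q) * (y + z) + suc q * (x + y) ≡
            (suc (suc q) * z + suc q * y) + (suc q * y + q * x) + (x + y)
  regroup = solve-∀
  collect : ∀ c x y → c * y + c * x + (x + y) ≡ suc c * (x + y)
  collect = solve-∀

-- The coefficient of uᵖ in (1+u) G′ for G = (1+u)ᶜ (1+(1+u)ᵏ)ᵐ⁺¹.
binomialSum-absorb : ∀ k m p c →
  suc p * binomialSum k (_C suc p) (suc m) c + p * binomialSum k (_C p) (suc m) c ≡
  c * binomialSum k (_C p) (suc m) c + suc m * (k * binomialSum k (_C p) m (c + k))
binomialSum-absorb k zero p c = begin
  suc p * (a₁ + b₁) + p * (a₀ + b₀)                   ≡⟨ regroup p a₀ a₁ b₀ b₁ ⟩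
  (suc p * a₁ + p * a₀) + (suc p * b₁ + p * b₀)       ≡⟨ cong₂ _+_ (C-absorb c p) (C-absorb (c + k) p) ⟩
  c * a₀ + (c + k) * b₀                               ≡⟨ collect c k a₀ b₀ ⟩
  c * (a₀ + b₀) + 1 * (k * b₀)                        ∎
  where
  open ≡-Reasoning
  a₀ a₁ b₀ b₁ : ℕ
  a₀ = c C p
  a₁ = c C suc p
  b₀ = (c + k) C p
  b₁ = (c + k) C suc p
  regroup : ∀ p a₀ a₁ b₀ b₁ → suc p * (a₁ + b₁) + p * (a₀ + b₀) ≡
            (suc p * a₁ + p * a₀) + (suc p * b₁ + p * b₀)
  regroup = solve-∀
  collect : ∀ c k a b → c * a + (c + k) * b ≡ c * (a + b) + 1 * (k * b)
  collect = solve-∀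
binomialSum-absorb k (suc m) p c = begin
  suc p * (a₁ + b₁) + p * (a₀ + b₀)
    ≡⟨ regroup p a₀ a₁ b₀ b₁ ⟩
  (suc p * a₁ + p * a₀) + (suc p * b₁ + p * b₀)
    ≡⟨ cong₂ _+_ (binomialSum-absorb k m p c) (binomialSum-absorb k m p (c + k)) ⟩
  (c * a₀ + suc m * (k * x)) + ((c + k) * (x + y) + suc m * (k * y))
    -- By definition `b₀` is `x + y`, so the surplus `k * (x + y)` from the start `c + k` raises the
    -- factor `suc m` to `suc (suc m)`.
    ≡⟨ collect c k m a₀ x y ⟩
  c * (a₀ + (x + y)) + suc (suc m) * (k * (x + y)) ∎
  where
  open ≡-Reasoning
  a₀ a₁ b₀ b₁ x y : ℕ
  a₀ = binomialSum k (_C p) (suc m) c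
  a₁ = binomialSum k (_C suc p) (suc m) c
  b₀ = binomialSum k (_C p) (suc m) (c + k)
  b₁ = binomialSum k (_C suc p) (suc m) (c + k)
  x  = binomialSum k (_C p) m (c + k)
  y  = binomialSum k (_C p) m (c + k + k)
  regroup : ∀ p a₀ a₁ b₀ b₁ → suc p * (a₁ + b₁) + p * (a₀ + b₀) ≡
            (suc p * a₁ + p * a₀) + (suc p * b₁ + p * b₀)
  regroup = solve-∀
  collect : ∀ c k m a x y → (c * a + suc m * (k * x)) + ((c + k) * (x + y) + suc m * (k * y)) ≡
            c * (a + (x + y)) + suc (suc m) * (k * (x + y))
  collect = solve-∀

-- The choice p = m, c = m + a in `binomialSum-absorb`: the terms `m * b` cancel and only `a * b` is
-- left.
binomialSum-diagonal : ∀ k m a →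
  suc m * binomialSum k (_C suc m) (suc m) (m + a) ≡
  a * binomialSum k (_C m) (suc m) (m + a) + suc m * (k * binomialSum k (_C m) m (m + a + k))
binomialSum-diagonal k m a = +-cancelʳ-≡ (m * b) _ _
  (trans (binomialSum-absorb k m m (m + a)) (arith m a b _))
  where
  b : ℕ
  b = binomialSum k (_C m) (suc m) (m + a)
  arith : ∀ m a b x → (m + a) * b + x ≡ a * b + x + m * b
  arith = solve-∀

-- Path counts

-- pathCount k m a counts completions from height a − 1, so that a = 0 is the
-- forbidden height −1; the value at m = a = 0 is junk, chosen to make the
-- generating function in m the a-th power of that of a = 1.
pathCount : ℕ → ℕ → ℕ → ℕ
pathCount k zero    a       = 1
pathCount k (suc m) zero    = 0
pathCount k (suc m) (suc a) = pathCount k (suc m) a + (pathCount k m (suc a + k) + pathCount k m (suc a))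

-- Induction on `m`, then on `a`: Pascal's rule in the start of the sums reproduces the recurrence
-- of `pathCount`. The boundary value 0 at `a = 0` is the diagonal identity with its first term
-- gone, divided by `suc m`.
pathCount-binomialSum : ∀ k m a →
  pathCount k (suc m) a + k * binomialSum k (_C m) m (m + a + k) ≡
  binomialSum k (_C suc m) (suc m) (m + a)
pathCount-binomialSum k m zero =
  sym (*-cancelˡ-≡ _ _ (suc m) (binomialSum-diagonal k m 0))
-- The induction hypothesis concerns positive step counts only, so the up and horizontal terms enter
-- here as the constants 1 and 1.
pathCount-binomialSum k zero (suc a) = begin
  (t + 2) + k * 1                                   ≡⟨ arith t (k * 1) ⟩
  1 + 1 + (t + k * 1)                               ≡⟨ cong (λ x → 1 + 1 + x) (pathCount-binomialSum k 0 a) ⟩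
  1 + 1 + binomialSum k (_C 1) 1 a                  ≡⟨ binomialSum-C-suc k 1 0 a ⟨
  binomialSum k (_C 1) 1 (suc a)                    ∎
  where
  open ≡-Reasoning
  t : ℕ
  t = pathCount k 1 a
  arith : ∀ t x → t + 2 + x ≡ 1 + 1 + (t + x)
  arith = solve-∀
pathCount-binomialSum k (suc m) (suc a) = begin
  t + (u + v) + k * B (suc m) (suc m) (suc m + suc a + k)
    ≡⟨ cong (λ x → t + (u + v) + k * B (suc m) (suc m) (x + k)) (+-suc (suc m) a) ⟩
  t + (u + v) + k * B (suc m) (suc m) (suc (c + k))
    ≡⟨ cong (λ x → t + (u + v) + k * x) (binomialSum-C-suc k (suc m) m (c + k)) ⟩
  t + (u + v) + k * (B m m (c + k) + B m m (c + k + k) + B (suc m) (suc m) (c + k))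
    -- Each of the three sums joins the count of one first step: horizontal (`v`), up (`u`), down
    -- (`t`).
    ≡⟨ regroup k t u v (B m m (c + k)) (B m m (c + k + k)) (B (suc m) (suc m) (c + k)) ⟩
  (v + k * B m m (c + k)) + (u + k * B m m (c + k + k)) + (t + k * B (suc m) (suc m) (c + k))
    ≡⟨ cong₂ _+_ (cong₂ _+_ eq-v eq-u) (pathCount-binomialSum k (suc m) a) ⟩
  B (suc m) (suc m) c + B (suc m) (suc m) (c + k) + B (suc (suc m)) (suc (suc m)) c
    ≡⟨ binomialSum-C-suc k (suc (suc m)) (suc m) c ⟨
  B (suc (suc m)) (suc (suc m)) (suc c)
    ≡⟨ cong (B (suc (suc m)) (suc (suc m))) (+-suc (suc m) a) ⟨
  B (suc (suc m)) (suc (suc m)) (suc m + suc a) ∎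
  where
  open ≡-Reasoning
  B : ℕ → ℕ → ℕ → ℕ
  B m p = binomialSum k (_C p) m
  c t u v : ℕ
  c = suc m + a
  t = pathCount k (suc (suc m)) a
  u = pathCount k (suc m) (suc a + k)
  v = pathCount k (suc m) (suc a)
  regroup : ∀ k t u v x y z → t + (u + v) + k * (x + y + z) ≡
            (v + k * x) + (u + k * y) + (t + k * z)
  regroup = solve-∀
  eq-v : v + k * B m m (c + k) ≡ B (suc m) (suc m) c
  eq-v = subst (λ x → v + k * B m m (x + k) ≡ B (suc m) (suc m) x)
               (+-suc m a) (pathCount-binomialSum k m (suc a))
  eq-u : u + k * B m m (c + k + k) ≡ B (suc m) (suc m) (c + k)
  eq-u = subst (λ x → u + k * B m m (x + k) ≡ B (suc m) (suc m) x)
               (shift m a k) (pathCount-binomialSum k m (suc a + k))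
    where
    shift : ∀ m a k → m + (suc a + k) ≡ suc m + a + k
    shift = solve-∀

-- After multiplication by `suc m`, the previous identity and the diagonal one share the same
-- `k`-term, which cancels.
pathCount-closed : ∀ k m a →
  suc m * pathCount k (suc m) a ≡ a * binomialSum k (_C m) (suc m) (m + a)
pathCount-closed k m a = +-cancelʳ-≡ (suc m * (k * w)) _ _ (begin
  suc m * t + suc m * (k * w)                        ≡⟨ *-distribˡ-+ (suc m) t (k * w) ⟨
  suc m * (t + k * w)                                ≡⟨ cong (suc m *_) (pathCount-binomialSum k m a) ⟩
  suc m * binomialSum k (_C suc m) (suc m) (m + a)   ≡⟨ binomialSum-diagonal k m a ⟩
  a * binomialSum k (_C m) (suc m) (m + a) + suc m * (k * w) ∎)
  where
  open ≡-Reasoning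
  t w : ℕ
  t = pathCount k (suc m) a
  w = binomialSum k (_C m) m (m + a + k)

-- Paths indexed by height

-- Ways to reach height 0 from height h, with m steps U or H.
data Path (k : ℕ) : ℕ → ℕ → Set where
  nil  : Path k 0 0
  up   : ∀ {m h} → Path k m (h + k) → Path k (suc m) h
  hor  : ∀ {m h} → Path k m h → Path k (suc m) h
  down : ∀ {m h} → Path k m h → Path k m (suc h)

Path-base : ∀ {k} → Path k 0 0 ↔ ⊤
Path-base = mk↔ₛ′ (λ _ → tt) (λ _ → nil) (λ _ → refl) λ { nil → refl }

Path-descent : ∀ {k h} → Path k 0 (suc h) ↔ Path k 0 h
Path-descent = mk↔ₛ′ (λ { (down p) → p }) down (λ _ → refl) λ { (down _) → refl }

Path-ground : ∀ {k m} → Path k (suc m) 0 ↔ (Path k m k ⊎ Path k m 0)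
Path-ground = mk↔ₛ′
  (λ { (up p) → inj₁ p ; (hor p) → inj₂ p })
  (λ { (inj₁ p) → up p ; (inj₂ p) → hor p })
  (λ { (inj₁ _) → refl ; (inj₂ _) → refl })
  (λ { (up _) → refl ; (hor _) → refl })

Path-split : ∀ {k m h} → Path k (suc m) (suc h) ↔
             (Path k (suc m) h ⊎ (Path k m (suc h + k) ⊎ Path k m (suc h)))
Path-split = mk↔ₛ′
  (λ { (down p) → inj₁ p ; (up p) → inj₂ (inj₁ p) ; (hor p) → inj₂ (inj₂ p) })
  (λ { (inj₁ p) → down p ; (inj₂ (inj₁ p)) → up p ; (inj₂ (inj₂ p)) → hor p })
  (λ { (inj₁ _) → refl ; (inj₂ (inj₁ _)) → refl ; (inj₂ (inj₂ _)) → refl })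
  (λ { (down _) → refl ; (up _) → refl ; (hor _) → refl })

-- Splitting off the first step mirrors the recurrence; the `suc` is the offset between height and
-- second argument.
Path↔Fin : ∀ k m h → Path k m h ↔ Fin (pathCount k m (suc h))
Path↔Fin k zero    zero    = ↔-sym 1↔⊤ ↔-∘ Path-base
Path↔Fin k zero    (suc h) = Path↔Fin k zero h ↔-∘ Path-descent
-- No down step leaves the ground: its summand `pathCount k (suc m) 0` computes to 0.
Path↔Fin k (suc m) zero    =
  ↔-sym +↔⊎ ↔-∘ ((Path↔Fin k m k ⊎-cong Path↔Fin k m 0) ↔-∘ Path-ground)
Path↔Fin k (suc m) (suc h) =
  ↔-sym +↔⊎ ↔-∘ ((Path↔Fin k (suc m) h ⊎-cong
    (↔-sym +↔⊎ ↔-∘ (Path↔Fin k m (suc h + k) ⊎-cong Path↔Fin k m (suc h)))) ↔-∘ Path-split)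

-- Indexed paths as step sequences

toSteps : ∀ {k m h} → Path k m h → List Step
toSteps nil      = []
toSteps (up p)   = U ∷ toSteps p
toSteps (hor p)  = H ∷ toSteps p
toSteps (down p) = D ∷ toSteps p

toSteps-injective : ∀ {k m h} (p q : Path k m h) → toSteps p ≡ toSteps q → p ≡ q
toSteps-injective nil      nil      eq = refl
toSteps-injective (up p)   (up q)   eq = cong up (toSteps-injective p q (∷-injectiveʳ eq))
toSteps-injective (hor p)  (hor q)  eq = cong hor (toSteps-injective p q (∷-injectiveʳ eq))
toSteps-injective (down p) (down q) eq = cong down (toSteps-injective p q (∷-injectiveʳ eq))

-- The invariant `x + h ≡ k * y` says, without subtraction, that `h` is the height of `(x , y)`. It
-- is carried along each kind of step in the unsimplified coordinates that `_⊕_` yields.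
height-U : ∀ k x y h → x + h ≡ k * y → x + 0 + (h + k) ≡ k * (y + 1)
height-U k x y h eq = trans (lhs x h k) (trans (cong (_+ k) eq) (rhs k y))
  where
  lhs : ∀ x h k → x + 0 + (h + k) ≡ x + h + k
  lhs = solve-∀
  rhs : ∀ k y → k * y + k ≡ k * (y + 1)
  rhs = solve-∀

height-H : ∀ k x y h → x + h ≡ k * y → x + k + h ≡ k * (y + 1)
height-H k x y h eq = trans (swap x h k) (height-U k x y h eq)
  where
  swap : ∀ x h k → x + k + h ≡ x + 0 + (h + k)
  swap = solve-∀

height-D : ∀ k x y h → x + suc h ≡ k * y → x + 1 + h ≡ k * (y + 0)
height-D k x y h eq = trans (+-assoc x 1 h) (trans eq (cong (k *_) (sym (+-identityʳ y))))

toSteps-endpoint : ∀ {k m h} (p : Path k m h) x y → x + h ≡ k * y →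
                   endpoint k (x , y) (toSteps p) ≡ (k * (y + m) , y + m)
toSteps-endpoint {k} nil x y eq =
  cong₂ _,_ (trans (sym (+-identityʳ x)) (trans eq (cong (k *_) (sym (+-identityʳ y)))))
            (sym (+-identityʳ y))
toSteps-endpoint {k} {suc m} (up p) x y eq =
  trans (toSteps-endpoint p _ _ (height-U k x y _ eq)) (cong (λ z → k * z , z) (+-assoc y 1 m))
toSteps-endpoint {k} {suc m} (hor p) x y eq =
  trans (toSteps-endpoint p _ _ (height-H k x y _ eq)) (cong (λ z → k * z , z) (+-assoc y 1 m))
toSteps-endpoint {k} {m} (down p) x y eq =
  trans (toSteps-endpoint p _ _ (height-D k x y _ eq))
        (cong (λ z → k * z , z) (cong (_+ m) (+-identityʳ y)))

-- Heights are natural numbers, so the invariant itself bounds `x` by `k * y`.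
toSteps-notBelow : ∀ {k m h} (p : Path k m h) x y → x + h ≡ k * y →
                   All (NotBelow k) (vertices k (x , y) (toSteps p))
toSteps-notBelow nil x y eq = m+n≤o⇒m≤o x (≤-reflexive eq) ∷ []
toSteps-notBelow {k} (up p) x y eq =
  m+n≤o⇒m≤o x (≤-reflexive eq) ∷ toSteps-notBelow p _ _ (height-U k x y _ eq)
toSteps-notBelow {k} (hor p) x y eq =
  m+n≤o⇒m≤o x (≤-reflexive eq) ∷ toSteps-notBelow p _ _ (height-H k x y _ eq)
toSteps-notBelow {k} (down p) x y eq =
  m+n≤o⇒m≤o x (≤-reflexive eq) ∷ toSteps-notBelow p _ _ (height-D k x y _ eq)

-- Parsing from the end backwards: the endpoint has height 0, and each step fixes the indices at its
-- start from those of the tail.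
toSteps-surjective : ∀ {k n} ss x y → endpoint k (x , y) ss ≡ (k * n , n) →
                     All (NotBelow k) (vertices k (x , y) ss) →
                     ∃[ m ] ∃[ h ] y + m ≡ n × x + h ≡ k * y × Σ (Path k m h) λ p → toSteps p ≡ ss
toSteps-surjective [] x y refl _ = 0 , 0 , +-identityʳ y , +-identityʳ x , nil , refl
toSteps-surjective {k} (U ∷ ss) x y end (x≤ky ∷ ok)
  -- The bound at this vertex supplies its height `h`; cancellation then shows the tail's height to
  -- be `h + k`, as `up` demands.
  with h , x+h≡ky ← m≤n⇒∃[o]m+o≡n x≤ky
  with m , h′ , refl , hEq , p , refl ← toSteps-surjective ss (x + 0) (y + 1) end ok
  with refl ← +-cancelˡ-≡ (x + 0) h′ (h + k) (trans hEq (sym (height-U k x y h x+h≡ky)))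
  = suc m , h , sym (+-assoc y 1 m) , x+h≡ky , up p , refl
toSteps-surjective {k} (D ∷ ss) x y end (_ ∷ ok)
  with m , h , refl , hEq , p , refl ← toSteps-surjective ss (x + 1) (y + 0) end ok
  = m , suc h , cong (_+ m) (sym (+-identityʳ y))
  , trans (sym (+-assoc x 1 h)) (trans hEq (cong (k *_) (+-identityʳ y))) , down p , refl
toSteps-surjective {k} (H ∷ ss) x y end (x≤ky ∷ ok)
  with h , x+h≡ky ← m≤n⇒∃[o]m+o≡n x≤ky
  with m , h′ , refl , hEq , p , refl ← toSteps-surjective ss (x + k) (y + 1) end ok
  with refl ← +-cancelˡ-≡ (x + k) h′ h (trans hEq (sym (height-H k x y h x+h≡ky)))
  = suc m , h , sym (+-assoc y 1 m) , x+h≡ky , hor p , refl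

SchA-≡ : ∀ {n k} {p q : SchA n k} → SchA.steps p ≡ SchA.steps q → p ≡ q
SchA-≡ {p = mkSchA ss e a} {mkSchA _ e′ a′} refl = cong₂ (mkSchA ss)
  (Decidable⇒UIP.≡-irrelevant (≡-dec _≟_ _≟_) e e′) (All.irrelevant ≤-irrelevant a a′)

-- Both inverse laws come from the one fact that parsing preserves the step sequence, which
-- determines the element on either side.
SchA↔Path : ∀ n k → SchA n k ↔ Path k n 0
SchA↔Path n k = mk↔ₛ′ to from
  (λ p → toSteps-injective _ p (toSteps-to (from p)))
  (λ s → SchA-≡ (toSteps-to s))
  where
  parse : (s : SchA n k) → Σ (Path k n 0) λ p → toSteps p ≡ SchA.steps s
  parse (mkSchA ss end ok)
    with m , h , refl , h≡k*0 , p , eq ← toSteps-surjective ss 0 0 end ok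
    -- The origin lies on the line, so the parsed path starts at height 0.
    with refl ← trans h≡k*0 (*-zeroʳ k)
    = p , eq
  to : SchA n k → Path k n 0
  to s = proj₁ (parse s)
  toSteps-to : ∀ s → toSteps (to s) ≡ SchA.steps s
  toSteps-to s = proj₂ (parse s)
  from : Path k n 0 → SchA n k
  from p = mkSchA (toSteps p) (toSteps-endpoint p 0 0 (sym (*-zeroʳ k)))
                  (toSteps-notBelow p 0 0 (sym (*-zeroʳ k)))

-- The formula over the rationals

-- Since `_/_` reduces fractions, the equation is checked on unnormalised rationals, where it is a
-- cross-multiplication.
/-solve : ∀ n N S → suc n * N ≡ S → + N / 1 ≡ (+ 1 / suc n) *ℚ (+ S / 1)
/-solve n N S eq = toℚᵘ-injective (begin
  toℚᵘ (+ N / 1)                          ≈⟨ toℚᵘ-fromℚᵘ (mkℚᵘ (+ N) 0) ⟩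
  mkℚᵘ (+ N) 0                            ≈⟨ *≡* cross ⟩
  mkℚᵘ (+ 1) n *ᵘ mkℚᵘ (+ S) 0
    ≈⟨ ℚᵘ.*-cong (toℚᵘ-fromℚᵘ (mkℚᵘ (+ 1) n)) (toℚᵘ-fromℚᵘ (mkℚᵘ (+ S) 0)) ⟨
  toℚᵘ (+ 1 / suc n) *ᵘ toℚᵘ (+ S / 1)  ≈⟨ toℚᵘ-homo-* (+ 1 / suc n) (+ S / 1) ⟨
  toℚᵘ ((+ 1 / suc n) *ℚ (+ S / 1))       ∎)
  where
  open ℚᵘ.≃-Reasoning
  cross : + N ℤ.* + (suc n * 1) ≡ (+ 1 ℤ.* + S) ℤ.* + 1
  cross = trans (sym (ℤ.pos-* N (suc n * 1)))
    (trans (cong +_ (trans (trans (cong (N *_) (*-identityʳ (suc n))) (*-comm N (suc n))) eq))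
           (sym (trans (ℤ.*-identityʳ _) (ℤ.*-identityˡ _))))

proposition4p20 : (k n : ℕ) .{{_ : NonZero k}} .{{_ : NonZero n}} →
    ∃[ N ] (SchA n k ↔ Fin N)
    × (+ N / 1 ≡ (+ 1 / n) *ℚ (+ sum (map (λ j → (n C j) * ((n + k * j) C (n ∸ 1))) (upTo (suc n))) / 1))
proposition4p20 k (suc m) =
  -- The argument 1 encodes the starting height 0.
  pathCount k (suc m) 1 ,
  Path↔Fin k (suc m) 0 ↔-∘ SchA↔Path (suc m) k ,
  /-solve m _ _ (begin
    suc m * pathCount k (suc m) 1                    ≡⟨ pathCount-closed k m 1 ⟩
    1 * binomialSum k (_C m) (suc m) (m + 1)         ≡⟨ *-identityˡ _ ⟩
    binomialSum k (_C m) (suc m) (m + 1)             ≡⟨ cong (binomialSum k (_C m) (suc m)) (+-comm m 1) ⟩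
    binomialSum k (_C m) (suc m) (suc m)             ≡⟨ sum-C≡binomialSum k (_C m) (suc m) (suc m) ⟨
    sum (applyUpTo F (suc (suc m)))                  ≡⟨ cong sum (map-upTo F (suc (suc m))) ⟨
    sum (map F (upTo (suc (suc m))))                 ∎)
  where
  open ≡-Reasoning
  F : ℕ → ℕ
  F j = (suc m C j) * ((suc m + k * j) C m)
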